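{- Let $(S,+)$ be a commutative semigroup and let $A\subseteq S$ be a set of A.P. rich. Fix $l\in\mathbb{N}$ and put \[ B=\{(a,b)\in S\times S:\ \{a,\,a+b,\,a+2b,\dots,\,a+lb\}\subseteq A\}. \] Then $B$ is a set of A.P. rich in the semigroup $S\times S$ (with coordinatewise addition).
   Context: Semigroups are written additively; for $n\in\mathbb{N}$ and $b\in S$, $nb$ denotes $b+b+\dots+b$ ($n$ summands), and $a+0b$ means $a$. An arithmetic progression of length $k$ in a semigroup $T$ is a set $\{a,\,a+b,\,a+2b,\dots,\,a+kb\}$ with $a,b\in T$ (if $T$ has an identity element, $b$ is required not to be the identity). A subset $A$ of a semigroup $T$ is called a set of A.P. rich if it contains arithmetic progressions of arbitrary length, i.e. for every $k\in\mathbb{N}$ there exist $a,b\in T$ with $a+ib\in A$ for all $0\le i\le k$. $S\times S$ is a semigroup under coordinatewise addition. -}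

module Defs where

open import Algebra.Bundles using (Semigroup)
open import Algebra.Definitions using (Identity)
open import Data.Nat.Base using (ℕ; zero; suc; _≤_)
open import Data.Product.Base using (∃-syntax; _×_; _,_)
open import Level using (_⊔_)
open import Relation.Nullary.Negation.Core using (¬_)
open import Relation.Unary using (Pred; _⊆_)

module _ {c ℓ} (T : Semigroup c ℓ) where
  open Semigroup T renaming (_∙_ to _+_)

  -- sucMultiple n b is (n + 1)b; a semigroup need not have a value for 0b.
  sucMultiple : ℕ → Carrier → Carrier
  sucMultiple zero    b = b
  sucMultiple (suc n) b = b + sucMultiple n b

  -- addMultiple a n b is a + nb, with a + 0b read as a.
  addMultiple : Carrier → ℕ → Carrier → Carrier
  addMultiple a zero    b = a
  addMultiple a (suc n) b = a + sucMultiple n b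

  -- The set {a, a + b, …, a + kb}, without any condition on b.
  progression : Carrier → Carrier → ℕ → Pred Carrier ℓ
  progression a b k x = ∃[ i ] (i ≤ k × x ≈ addMultiple a i b)

  -- Vacuous when T has no identity element.
  NotIdentity : Pred Carrier (c ⊔ ℓ)
  NotIdentity b = ∀ e → Identity _≈_ e _+_ → ¬ (b ≈ e)

  APRich : ∀ {p} → Pred Carrier p → Set (c ⊔ ℓ ⊔ p)
  APRich A = ∀ k → ∃[ a ] ∃[ b ] (NotIdentity b × progression a b k ⊆ A)

  -- Here b may be an identity element: only the inclusion is required.
  progressionPairs : ∀ {p} → Pred Carrier p → ℕ → Pred (Carrier × Carrier) (c ⊔ ℓ ⊔ p)
  progressionPairs A l (a , b) = progression a b l ⊆ A

{-# OPTIONS --safe #-}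

-- If a + nd ∈ A for all n ≤ k + l(1 + k), then the progression of pairs with
-- start (a , d) and difference (d , d) lies in B up to length k: its i-th term is
-- (a + id , (1 + i)d), and (a + id) + j((1 + i)d) = a + (i + j(1 + i))d.
module Submission where

open import Algebra.Bundles using (CommutativeSemigroup; Semigroup)
open import Algebra.Construct.DirectProduct using (semigroup)
open import Data.Nat.Base using (ℕ; zero; suc; _+_; _*_; s≤s)
open import Data.Nat.Properties using (+-identityʳ; +-suc; +-mono-≤; *-mono-≤)
open import Data.Product.Base using (_,_; proj₁; proj₂)
open import Relation.Binary.Definitions using (_Respects_)
open import Relation.Binary.PropositionalEquality.Core as ≡ using (_≡_)
open import Relation.Unary using (Pred)
open import Defs

module _ {c ℓ} (T : Semigroup c ℓ) where
  open Semigroup T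
  open import Relation.Binary.Reasoning.Setoid setoid

  sucMultiple-cong : ∀ n {b b′} → b ≈ b′ → sucMultiple T n b ≈ sucMultiple T n b′
  sucMultiple-cong zero    b≈b′ = b≈b′
  sucMultiple-cong (suc n) b≈b′ = ∙-cong b≈b′ (sucMultiple-cong n b≈b′)

  addMultiple-cong : ∀ {a a′} n {b b′} → a ≈ a′ → b ≈ b′ →
                     addMultiple T a n b ≈ addMultiple T a′ n b′
  addMultiple-cong zero    a≈a′ b≈b′ = a≈a′
  addMultiple-cong (suc n) a≈a′ b≈b′ = ∙-cong a≈a′ (sucMultiple-cong n b≈b′)

  -- Indices are one below coefficients: m + 1 and n + 1 summands make m + n + 2, whence the outer
  -- `suc`. Induction on `m` moves summands across by associativity.
  sucMultiple-+ : ∀ m n b →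
                  sucMultiple T m b ∙ sucMultiple T n b ≈ sucMultiple T (suc (m + n)) b
  sucMultiple-+ zero    n b = refl
  sucMultiple-+ (suc m) n b = trans (assoc _ _ _) (∙-congˡ (sucMultiple-+ m n b))

  -- The split on both counts follows the convention for a + 0b; `sucMultiple-+` applies only when
  -- both are positive.
  addMultiple-+ : ∀ a m n b →
                  addMultiple T (addMultiple T a m b) n b ≈ addMultiple T a (m + n) b
  addMultiple-+ a zero    n       b = refl
  addMultiple-+ a (suc m) zero    b =
    reflexive (≡.cong (λ k → a ∙ sucMultiple T k b) (≡.sym (+-identityʳ m)))
  addMultiple-+ a (suc m) (suc n) b = begin
    (a ∙ sucMultiple T m b) ∙ sucMultiple T n b  ≈⟨ assoc _ _ _ ⟩
    a ∙ (sucMultiple T m b ∙ sucMultiple T n b)  ≈⟨ ∙-congˡ (sucMultiple-+ m n b) ⟩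
    a ∙ sucMultiple T (suc (m + n)) b            ≡⟨ ≡.cong (λ k → a ∙ sucMultiple T k b) (+-suc m n) ⟨
    a ∙ sucMultiple T (m + suc n) b              ∎

  -- The coefficient is (n + 1)(m + 1), and `m + n * suc m` is its predecessor.
  sucMultiple-* : ∀ n m b →
                  sucMultiple T n (sucMultiple T m b) ≈ sucMultiple T (m + n * suc m) b
  sucMultiple-* zero    m b =
    reflexive (≡.cong (λ k → sucMultiple T k b) (≡.sym (+-identityʳ m)))
  sucMultiple-* (suc n) m b = begin
    sucMultiple T m b ∙ sucMultiple T n (sucMultiple T m b)  ≈⟨ ∙-congˡ (sucMultiple-* n m b) ⟩
    sucMultiple T m b ∙ sucMultiple T (m + n * suc m) b      ≈⟨ sucMultiple-+ m (m + n * suc m) b ⟩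
    sucMultiple T (suc (m + (m + n * suc m))) b              ≡⟨ ≡.cong (λ k → sucMultiple T k b) (+-suc m (m + n * suc m)) ⟨
    sucMultiple T (m + suc n * suc m) b                      ∎

  addMultiple-* : ∀ a n m b →
                  addMultiple T a n (sucMultiple T m b) ≈ addMultiple T a (n * suc m) b
  addMultiple-* a zero    m b = refl
  addMultiple-* a (suc n) m b = ∙-congˡ (sucMultiple-* n m b)

  -- Turns the second coordinate d + id of a pair into (1 + i)d, the form that `addMultiple-*` takes
  -- as difference.
  addMultiple-self : ∀ n b → addMultiple T b n b ≡ sucMultiple T n b
  addMultiple-self zero    b = ≡.refl
  addMultiple-self (suc n) b = ≡.refl

  addMultiple-nested : ∀ a b i j →
    addMultiple T (addMultiple T a i b) j (addMultiple T b i b) ≈ addMultiple T a (i + j * suc i) b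
  addMultiple-nested a b i j = begin
    addMultiple T (addMultiple T a i b) j (addMultiple T b i b)
      ≡⟨ ≡.cong (addMultiple T (addMultiple T a i b) j) (addMultiple-self i b) ⟩
    addMultiple T (addMultiple T a i b) j (sucMultiple T i b)
      ≈⟨ addMultiple-* (addMultiple T a i b) j i b ⟩
    addMultiple T (addMultiple T a i b) (j * suc i) b
      ≈⟨ addMultiple-+ a i (j * suc i) b ⟩
    addMultiple T a (i + j * suc i) b ∎

module _ {c₁ ℓ₁ c₂ ℓ₂} (S : Semigroup c₁ ℓ₁) (T : Semigroup c₂ ℓ₂) where
  private
    module S = Semigroup S
    module T = Semigroup T

  -- Stated with `≡` rather than the setoid equality so that it can be used in `rewrite`.
  sucMultiple-× : ∀ n s t →
    sucMultiple (semigroup S T) n (s , t) ≡ (sucMultiple S n s , sucMultiple T n t)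
  sucMultiple-× zero    s t = ≡.refl
  sucMultiple-× (suc n) s t rewrite sucMultiple-× n s t = ≡.refl

  addMultiple-× : ∀ s t n s′ t′ →
    addMultiple (semigroup S T) (s , t) n (s′ , t′) ≡ (addMultiple S s n s′ , addMultiple T t n t′)
  addMultiple-× s t zero    s′ t′ = ≡.refl
  addMultiple-× s t (suc n) s′ t′ rewrite sucMultiple-× n s′ t′ = ≡.refl

  -- The first coordinate of an identity of the product is an identity of `S`: test it on the pairs
  -- `(x , t)`.
  NotIdentity-×ˡ : ∀ {s} (t : T.Carrier) → NotIdentity S s → NotIdentity (semigroup S T) (s , t)
  NotIdentity-×ˡ t s≉0 (e , _) (idˡ , idʳ) (s≈e , _) =
    s≉0 e ((λ x → proj₁ (idˡ (x , t))) , (λ x → proj₁ (idʳ (x , t)))) s≈e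

theorem2 : ∀ {c ℓ p} (S : CommutativeSemigroup c ℓ) →
    let open CommutativeSemigroup S renaming (semigroup to S₊) in
    (A : Pred Carrier p) → A Respects _≈_ → APRich S₊ A →
    (l : ℕ) → APRich (semigroup S₊ S₊) (progressionPairs S₊ A l)
-- The length is the value of i + j(1 + i) at i = k, j = l, its maximum over i ≤ k and j ≤ l.
theorem2 S A _ rich l k with rich (k + l * suc k)
... | a , d , d≉0 , a+nd∈A = (a , d) , (d , d) , NotIdentity-×ˡ S₊ S₊ d d≉0 , pairs
  where
  open CommutativeSemigroup S using (trans) renaming (semigroup to S₊)

  pairs : ∀ {x} → progression (semigroup S₊ S₊) (a , d) (d , d) k x → progressionPairs S₊ A l x
  -- The pair `x` is only equivalent to the i-th term; after the rewrite, `x≈` gives this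
  -- equivalence in each coordinate.
  pairs (i , i≤k , x≈) (j , j≤l , y≈) rewrite addMultiple-× S₊ S₊ a d i d d =
    a+nd∈A (i + j * suc i , +-mono-≤ i≤k (*-mono-≤ j≤l (s≤s i≤k)) ,
      trans y≈ (trans (addMultiple-cong S₊ j (proj₁ x≈) (proj₂ x≈)) (addMultiple-nested S₊ a d i j)))
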